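{- For all integers $k\geq 1$: $k+1\in H(k+1,k)$, $2k-1\in H(k+2,k)$ and $2^{k-1}+1\in H(2k-1,k)$.
   Context: Let $\mathbb{H}^n:=\{0,1\}^n\subset\mathbb{R}^n$. For integers $n\geq k\geq 1$, $H(n,k)$ denotes the set of non-zero cardinalities of intersections of $\mathbb{H}^n$ with $k$-dimensional affine subspaces of $\mathbb{R}^n$: $H(n,k)=\{t>0:\exists\, S\subset\mathbb{R}^n \text{ affine subspace},\ \dim S=k,\ t=|\mathbb{H}^n\cap S|\}$. Equivalently (by the symmetries of the hypercube), with $m=n-k$, $H(n,k)=\{t:\exists\, L:\mathbb{R}^k\to\mathbb{R}^m \text{ linear},\ t=|\mathbb{H}^k\cap L^{ -1}(\mathbb{H}^m)|\}$. -}

module Defs where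

import Algebra.Definitions.RawMonoid as RawMonoidDefinitions
import Algebra.Properties.CommutativeSemigroup as CommutativeSemigroupProperties
import Algebra.Properties.Group as GroupProperties
import Algebra.Properties.Ring as RingProperties
open import Algebra.Bundles using (CommutativeMonoid; CommutativeRing)
open import Algebra.Structures using (IsCommutativeRing)
open import Data.Fin.Base using (Fin)
open import Data.Nat.Base as ℕ using (ℕ)
import Data.Nat.Properties as ℕ
open import Data.Product.Base using (Σ; ∃; ∃-syntax; _×_; _,_; proj₁; proj₂)
open import Data.Rational.Base as ℚ using (ℚ; 0ℚ; 1ℚ; ½)
import Data.Rational.Properties as ℚ
open import Data.Sum.Base using (_⊎_)
open import Data.Vec.Functional using (Vector; map; zipWith; replicate)
import Data.Vec.Functional.Relation.Binary.Equality.Setoid as VecEquality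
open import Function.Bundles using (Bijection)
open import Level using (0ℓ; suc)
open import Relation.Binary.Bundles using (Setoid)
open import Relation.Binary.PropositionalEquality as ≡ using (_≡_; refl; cong; sym; subst)
import Relation.Binary.Construct.On as On
open import Relation.Binary.Structures using (IsEquivalence)
open import Relation.Unary using (Pred; _∈_; _∩_)

infix 4 _~_

-- "The terms of x and of y get arbitrarily close to each other."  As m and n
-- vary independently, x ~ x says that x is a Cauchy sequence, and for Cauchy
-- sequences x ~ y says that x n - y n tends to 0, so the real numbers are the
-- self-related sequences of rationals modulo _~_.
_~_ : (x y : ℕ → ℚ) → Set
x ~ y = ∀ ε → 0ℚ ℚ.< ε →
        ∃[ N ] (∀ m n → N ℕ.≤ m → N ℕ.≤ n → ℚ.∣ x m ℚ.- y n ∣ ℚ.< ε)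

record Real : Set where
  constructor mkReal
  field
    seq    : ℕ → ℚ
    cauchy : seq ~ seq

open Real public

infix 4 _≈_

-- Equality of real numbers.  A record, rather than a synonym of seq x ~ seq y,
-- so that x and y can be inferred.
record _≈_ (x y : Real) : Set where
  constructor mk≈
  field
    close : seq x ~ seq y

open _≈_ public

private

  open GroupProperties ℚ.+-0-group using (⁻¹-anti-homo-//; //-rightDividesˡ)
  open CommutativeSemigroupProperties
    (CommutativeMonoid.commutativeSemigroup ℚ.+-0-commutativeMonoid) using (interchange)
  open RingProperties ℚ.+-*-ring using (x[y-z]≈xy-xz)

  half : ℚ → ℚ
  half ε = ½ ℚ.* ε

  abstract

    half>0 : ∀ {ε} → 0ℚ ℚ.< ε → 0ℚ ℚ.< half ε
    half>0 {ε} ε>0 = subst (ℚ._< half ε) (ℚ.*-zeroʳ ½) (ℚ.*-monoʳ-<-pos ½ ε>0)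

    half+half : ∀ ε → half ε ℚ.+ half ε ≡ ε
    half+half ε = ≡.trans (sym (ℚ.*-distribʳ-+ ε ½ ½)) (ℚ.*-identityˡ ε)

    +-close : ∀ {p q r ε} → p ≡ q ℚ.+ r →
              ℚ.∣ q ∣ ℚ.< half ε → ℚ.∣ r ∣ ℚ.< half ε → ℚ.∣ p ∣ ℚ.< ε
    +-close {q = q} {r} {ε} refl q< r< =
      subst (_ ℚ.<_) (half+half ε)
        (ℚ.≤-<-trans (ℚ.∣p+q∣≤∣p∣+∣q∣ q r) (ℚ.+-mono-< q< r<))

    telescope : ∀ p q r → p ℚ.- r ≡ (p ℚ.- q) ℚ.+ (q ℚ.- r)
    telescope p q r = sym (≡.trans (sym (ℚ.+-assoc (p ℚ.- q) q (ℚ.- r)))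
                                   (cong (ℚ._- r) (//-rightDividesˡ q p)))

    *-telescope : ∀ p q r s →
      p ℚ.* q ℚ.- r ℚ.* s ≡ p ℚ.* (q ℚ.- s) ℚ.+ s ℚ.* (p ℚ.- r)
    *-telescope p q r s = begin
      p ℚ.* q ℚ.- r ℚ.* s
        ≡⟨ telescope (p ℚ.* q) (p ℚ.* s) (r ℚ.* s) ⟩
      (p ℚ.* q ℚ.- p ℚ.* s) ℚ.+ (p ℚ.* s ℚ.- r ℚ.* s)
        ≡⟨ ≡.cong₂ (λ t u → (p ℚ.* q ℚ.- p ℚ.* s) ℚ.+ (t ℚ.- u)) (ℚ.*-comm p s) (ℚ.*-comm r s) ⟩
      (p ℚ.* q ℚ.- p ℚ.* s) ℚ.+ (s ℚ.* p ℚ.- s ℚ.* r)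
        ≡⟨ ≡.cong₂ ℚ._+_ (x[y-z]≈xy-xz p q s) (x[y-z]≈xy-xz s p r) ⟨
      p ℚ.* (q ℚ.- s) ℚ.+ s ℚ.* (p ℚ.- r) ∎
      where open ≡.≡-Reasoning

    ~-sym : ∀ {x y} → x ~ y → y ~ x
    ~-sym {x} {y} x~y ε ε>0 with x~y ε ε>0
    ... | N , h = N , λ m n N≤m N≤n →
      subst (ℚ._< ε)
        (≡.trans (sym (ℚ.∣-p∣≡∣p∣ (x n ℚ.- y m)))
                 (cong ℚ.∣_∣ (⁻¹-anti-homo-// (x n) (y m))))
        (h n m N≤n N≤m)

    ~-trans : ∀ {x y z} → x ~ y → y ~ z → x ~ z
    ~-trans {x} {y} {z} x~y y~z ε ε>0
      with x~y (half ε) (half>0 ε>0) | y~z (half ε) (half>0 ε>0)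
    ... | M , f | N , g = M ℕ.⊔ N , λ m n ≤m ≤n →
      +-close
        (telescope (x m) (y (M ℕ.⊔ N)) (z n))
        (f m (M ℕ.⊔ N) (ℕ.m⊔n≤o⇒m≤o M N ≤m) (ℕ.m≤m⊔n M N))
        (g (M ℕ.⊔ N) n (ℕ.m≤n⊔m M N) (ℕ.m⊔n≤o⇒n≤o M N ≤n))

    +-~ : ∀ {x x′ y y′} → x ~ x′ → y ~ y′ →
          (λ n → x n ℚ.+ y n) ~ (λ n → x′ n ℚ.+ y′ n)
    +-~ {x} {x′} {y} {y′} x~x′ y~y′ ε ε>0
      with x~x′ (half ε) (half>0 ε>0) | y~y′ (half ε) (half>0 ε>0)
    ... | M , f | N , g = M ℕ.⊔ N , λ m n ≤m ≤n →
      +-close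
        (≡.trans (cong (x m ℚ.+ y m ℚ.+_) (ℚ.neg-distrib-+ (x′ n) (y′ n)))
                 (interchange (x m) (y m) (ℚ.- x′ n) (ℚ.- y′ n)))
        (f m n (ℕ.m⊔n≤o⇒m≤o M N ≤m) (ℕ.m⊔n≤o⇒m≤o M N ≤n))
        (g m n (ℕ.m⊔n≤o⇒n≤o M N ≤m) (ℕ.m⊔n≤o⇒n≤o M N ≤n))

    neg-~ : ∀ {x y} → x ~ y → (λ n → ℚ.- x n) ~ (λ n → ℚ.- y n)
    neg-~ {x} {y} x~y ε ε>0 with x~y ε ε>0
    ... | N , h = N , λ m n N≤m N≤n →
      subst (ℚ._< ε)
        (≡.trans (sym (ℚ.∣-p∣≡∣p∣ (x m ℚ.- y n)))
                 (cong ℚ.∣_∣ (ℚ.neg-distrib-+ (x m) (ℚ.- y n))))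
        (h m n N≤m N≤n)

    0<1 : 0ℚ ℚ.< 1ℚ
    0<1 = ℚ.positive⁻¹ 1ℚ

    bounded : ∀ {x y} → x ~ y →
              ∃[ B ] 0ℚ ℚ.< B × ∃[ N ] (∀ m → N ℕ.≤ m → ℚ.∣ x m ∣ ℚ.≤ B)
    bounded {x} {y} x~y with x~y 1ℚ 0<1
    ... | N , h = 1ℚ ℚ.+ ℚ.∣ y N ∣
                , ℚ.<-≤-trans 0<1
                    (subst (ℚ._≤ 1ℚ ℚ.+ ℚ.∣ y N ∣) (ℚ.+-identityʳ 1ℚ)
                       (ℚ.+-monoʳ-≤ 1ℚ (ℚ.0≤∣p∣ (y N))))
                , N , λ m N≤m →
      subst (λ p → ℚ.∣ p ∣ ℚ.≤ 1ℚ ℚ.+ ℚ.∣ y N ∣)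
        (//-rightDividesˡ (y N) (x m))
        (ℚ.≤-trans (ℚ.∣p+q∣≤∣p∣+∣q∣ (x m ℚ.- y N) (y N))
          (ℚ.+-monoˡ-≤ ℚ.∣ y N ∣ (ℚ.<⇒≤ (h m N N≤m ℕ.≤-refl))))

    1/⁺_ : ∀ B .{{_ : ℚ.Positive B}} → ℚ
    1/⁺ B = ℚ.1/_ B {{ℚ.pos⇒nonZero B}}

    1/B*ε>0 : ∀ B ε .{{_ : ℚ.Positive B}} →
              0ℚ ℚ.< ε → 0ℚ ℚ.< 1/⁺ B ℚ.* ε
    1/B*ε>0 B ε ε>0 = subst (ℚ._< 1/⁺ B ℚ.* ε) (ℚ.*-zeroʳ (1/⁺ B))
      (ℚ.*-monoʳ-<-pos (1/⁺ B) {{ℚ.1/pos⇒pos B}} ε>0)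

    B*1/B*ε≡ε : ∀ B ε .{{_ : ℚ.Positive B}} → B ℚ.* (1/⁺ B ℚ.* ε) ≡ ε
    B*1/B*ε≡ε B ε = ≡.trans (sym (ℚ.*-assoc B (1/⁺ B) ε))
      (≡.trans (cong (ℚ._* ε) (ℚ.*-inverseʳ B {{ℚ.pos⇒nonZero B}})) (ℚ.*-identityˡ ε))

    *-small⁺ : ∀ B ε .{{_ : ℚ.Positive B}} → 0ℚ ℚ.< ε →
               ∃[ δ ] 0ℚ ℚ.< δ ×
                 (∀ p q → ℚ.∣ p ∣ ℚ.≤ B → ℚ.∣ q ∣ ℚ.< δ → ℚ.∣ p ℚ.* q ∣ ℚ.< ε)
    *-small⁺ B ε ε>0 = 1/⁺ B ℚ.* ε , 1/B*ε>0 B ε ε>0 , λ p q p≤ q< →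
      subst (ℚ._< ε) (sym (ℚ.∣p*q∣≡∣p∣*∣q∣ p q))
        (ℚ.≤-<-trans
          (ℚ.*-monoʳ-≤-nonNeg ℚ.∣ q ∣ {{ℚ.∣-∣-nonNeg q}} p≤)
          (subst (B ℚ.* ℚ.∣ q ∣ ℚ.<_) (B*1/B*ε≡ε B ε) (ℚ.*-monoʳ-<-pos B q<)))

    *-small : ∀ {B ε} → 0ℚ ℚ.< B → 0ℚ ℚ.< ε →
              ∃[ δ ] 0ℚ ℚ.< δ ×
                (∀ p q → ℚ.∣ p ∣ ℚ.≤ B → ℚ.∣ q ∣ ℚ.< δ → ℚ.∣ p ℚ.* q ∣ ℚ.< ε)
    *-small {B} {ε} B>0 =
      *-small⁺ B ε {{ℚ.positive B>0}}

    *-~ : ∀ {x x′ y y′} → x ~ x′ → y ~ y′ →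
          (λ n → x n ℚ.* y n) ~ (λ n → x′ n ℚ.* y′ n)
    *-~ {x} {x′} {y} {y′} x~x′ y~y′ ε ε>0 =
      bounds (bounded {x} {x′} x~x′) (bounded {y′} {y} (~-sym {y} {y′} y~y′))
      where
      Goal : Set
      Goal = ∃[ N ] (∀ m n → N ℕ.≤ m → N ℕ.≤ n →
               ℚ.∣ x m ℚ.* y m ℚ.- x′ n ℚ.* y′ n ∣ ℚ.< ε)

      Small : ℚ → ℚ → Set
      Small B δ = ∀ p q → ℚ.∣ p ∣ ℚ.≤ B → ℚ.∣ q ∣ ℚ.< δ → ℚ.∣ p ℚ.* q ∣ ℚ.< half ε

      combine : ∀ {B C δ η} → Small B δ → Small C η →
        ∃[ K ] (∀ m → K ℕ.≤ m → ℚ.∣ x m ∣ ℚ.≤ B) →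
        ∃[ L ] (∀ n → L ℕ.≤ n → ℚ.∣ y′ n ∣ ℚ.≤ C) →
        ∃[ M ] (∀ m n → M ℕ.≤ m → M ℕ.≤ n → ℚ.∣ x m ℚ.- x′ n ∣ ℚ.< η) →
        ∃[ N ] (∀ m n → N ℕ.≤ m → N ℕ.≤ n → ℚ.∣ y m ℚ.- y′ n ∣ ℚ.< δ) → Goal
      combine b* c* (K , b) (L , c) (M , f) (N , g) =
        (K ℕ.⊔ L) ℕ.⊔ (M ℕ.⊔ N) , λ m n ≤m ≤n →
          +-close (*-telescope (x m) (y m) (x′ n) (y′ n))
            (b* (x m) (y m ℚ.- y′ n)
              (b m (ℕ.m⊔n≤o⇒m≤o K L (KL ≤m)))
              (g m n (ℕ.m⊔n≤o⇒n≤o M N (MN ≤m)) (ℕ.m⊔n≤o⇒n≤o M N (MN ≤n))))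
            (c* (y′ n) (x m ℚ.- x′ n)
              (c n (ℕ.m⊔n≤o⇒n≤o K L (KL ≤n)))
              (f m n (ℕ.m⊔n≤o⇒m≤o M N (MN ≤m)) (ℕ.m⊔n≤o⇒m≤o M N (MN ≤n))))
        where
        KL : ∀ {o} → (K ℕ.⊔ L) ℕ.⊔ (M ℕ.⊔ N) ℕ.≤ o → K ℕ.⊔ L ℕ.≤ o
        KL = ℕ.m⊔n≤o⇒m≤o (K ℕ.⊔ L) (M ℕ.⊔ N)
        MN : ∀ {o} → (K ℕ.⊔ L) ℕ.⊔ (M ℕ.⊔ N) ℕ.≤ o → M ℕ.⊔ N ℕ.≤ o
        MN = ℕ.m⊔n≤o⇒n≤o (K ℕ.⊔ L) (M ℕ.⊔ N)

      Small-at : ℚ → Set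
      Small-at B = ∃[ δ ] 0ℚ ℚ.< δ × Small B δ

      small : ∀ {B C} →
        ∃[ K ] (∀ m → K ℕ.≤ m → ℚ.∣ x m ∣ ℚ.≤ B) →
        ∃[ L ] (∀ n → L ℕ.≤ n → ℚ.∣ y′ n ∣ ℚ.≤ C) →
        Small-at B → Small-at C → Goal
      small b c (δ , δ>0 , b*) (η , η>0 , c*) =
        combine b* c* b c (x~x′ η η>0) (y~y′ δ δ>0)

      bounds : ∃[ B ] 0ℚ ℚ.< B × ∃[ K ] (∀ m → K ℕ.≤ m → ℚ.∣ x m ∣ ℚ.≤ B) →
               ∃[ C ] 0ℚ ℚ.< C × ∃[ L ] (∀ n → L ℕ.≤ n → ℚ.∣ y′ n ∣ ℚ.≤ C) → Goal
      bounds (B , B>0 , b) (C , C>0 , c) =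
        small b c (*-small B>0 (half>0 ε>0)) (*-small C>0 (half>0 ε>0))

    const-~ : ∀ q → (λ _ → q) ~ (λ _ → q)
    const-~ q ε ε>0 = 0 , λ _ _ _ _ →
      subst (ℚ._< ε) (sym (cong ℚ.∣_∣ (ℚ.+-inverseʳ q))) ε>0

infix  8 -_
infixl 7 _*_
infixl 6 _+_ _-_

fromℚ : ℚ → Real
fromℚ q = mkReal (λ _ → q) (const-~ q)

0ℝ 1ℝ : Real
0ℝ = fromℚ 0ℚ
1ℝ = fromℚ 1ℚ

_+_ _*_ : Real → Real → Real
x + y = mkReal (λ n → seq x n ℚ.+ seq y n)
               (+-~ {seq x} {seq x} {seq y} {seq y} (cauchy x) (cauchy y))
x * y = mkReal (λ n → seq x n ℚ.* seq y n)
               (*-~ {seq x} {seq x} {seq y} {seq y} (cauchy x) (cauchy y))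

-_ : Real → Real
-_ x = mkReal (λ n → ℚ.- seq x n) (neg-~ {seq x} {seq x} (cauchy x))

_-_ : Real → Real → Real
x - y = x + (- y)

pointwise⇒≈ : ∀ {x y} → (∀ n → seq x n ≡ seq y n) → x ≈ y
pointwise⇒≈ {x} {y} eq = mk≈ λ ε ε>0 → let (N , h) = cauchy x ε ε>0 in
  N , λ m n N≤m N≤n →
    subst (λ q → ℚ.∣ seq x m ℚ.- q ∣ ℚ.< ε) (eq n) (h m n N≤m N≤n)

≈-isEquivalence : IsEquivalence _≈_
≈-isEquivalence = record
  { refl  = λ {x} → mk≈ (cauchy x)
  ; sym   = λ {x} {y} p → mk≈ (~-sym {seq x} {seq y} (close p))
  ; trans = λ {x} {y} {z} p q →
              mk≈ (~-trans {seq x} {seq y} {seq z} (close p) (close q))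
  }

+-*-isCommutativeRing : IsCommutativeRing _≈_ _+_ _*_ -_ 0ℝ 1ℝ
+-*-isCommutativeRing = record
  { isRing = record
    { +-isAbelianGroup = record
      { isGroup = record
        { isMonoid = record
          { isSemigroup = record
            { isMagma = record
              { isEquivalence = ≈-isEquivalence
              ; ∙-cong = λ {x} {x′} {y} {y′} p q →
                  mk≈ (+-~ {seq x} {seq x′} {seq y} {seq y′} (close p) (close q))
              }
            ; assoc = λ x y z → pointwise⇒≈ λ n → ℚ.+-assoc (seq x n) (seq y n) (seq z n)
            }
          ; identity = (λ x → pointwise⇒≈ λ n → ℚ.+-identityˡ (seq x n))
                     , (λ x → pointwise⇒≈ λ n → ℚ.+-identityʳ (seq x n))
          }
        ; inverse = (λ x → pointwise⇒≈ λ n → ℚ.+-inverseˡ (seq x n))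
                  , (λ x → pointwise⇒≈ λ n → ℚ.+-inverseʳ (seq x n))
        ; ⁻¹-cong = λ {x} {y} p → mk≈ (neg-~ {seq x} {seq y} (close p))
        }
      ; comm = λ x y → pointwise⇒≈ λ n → ℚ.+-comm (seq x n) (seq y n)
      }
    ; *-cong = λ {x} {x′} {y} {y′} p q →
        mk≈ (*-~ {seq x} {seq x′} {seq y} {seq y′} (close p) (close q))
    ; *-assoc = λ x y z → pointwise⇒≈ λ n → ℚ.*-assoc (seq x n) (seq y n) (seq z n)
    ; *-identity = (λ x → pointwise⇒≈ λ n → ℚ.*-identityˡ (seq x n))
                 , (λ x → pointwise⇒≈ λ n → ℚ.*-identityʳ (seq x n))
    ; distrib = (λ x y z → pointwise⇒≈ λ n → ℚ.*-distribˡ-+ (seq x n) (seq y n) (seq z n))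
              , (λ x y z → pointwise⇒≈ λ n → ℚ.*-distribʳ-+ (seq x n) (seq y n) (seq z n))
    }
  ; *-comm = λ x y → pointwise⇒≈ λ n → ℚ.*-comm (seq x n) (seq y n)
  }

ℝ-commutativeRing : CommutativeRing 0ℓ 0ℓ
ℝ-commutativeRing = record { isCommutativeRing = +-*-isCommutativeRing }

module ℝ = CommutativeRing ℝ-commutativeRing

open VecEquality ℝ.setoid public using (_≋_; ≋-setoid)
open RawMonoidDefinitions ℝ.+-rawMonoid public using (sum)

ℝ^ : ℕ → Set
ℝ^ n = Vector Real n

infixl 7 _·ⱽ_
infixl 6 _+ⱽ_ _-ⱽ_

0ⱽ : ∀ {n} → ℝ^ n
0ⱽ {n} = replicate n 0ℝ

_+ⱽ_ _-ⱽ_ : ∀ {n} → ℝ^ n → ℝ^ n → ℝ^ n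
_+ⱽ_ = zipWith _+_
_-ⱽ_ = zipWith _-_

_·ⱽ_ : ∀ {n} → Real → ℝ^ n → ℝ^ n
c ·ⱽ v = map (c *_) v

linearCombination : ∀ {n k} → Vector Real k → Vector (ℝ^ n) k → ℝ^ n
linearCombination c v i = sum (λ j → c j * v j i)

record LinearSubspace (n : ℕ) : Set₁ where
  field
    Member : Pred (ℝ^ n) 0ℓ
    resp   : ∀ {v w} → v ≋ w → v ∈ Member → w ∈ Member
    0∈     : 0ⱽ ∈ Member
    +∈     : ∀ {v w} → v ∈ Member → w ∈ Member → (v +ⱽ w) ∈ Member
    ·∈     : ∀ c {v} → v ∈ Member → (c ·ⱽ v) ∈ Member

record Basis {n} (V : LinearSubspace n) (k : ℕ) : Set where
  open LinearSubspace V
  field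
    vectors     : Vector (ℝ^ n) k
    members     : ∀ j → vectors j ∈ Member
    independent : ∀ c → linearCombination c vectors ≋ 0ⱽ → ∀ j → c j ≈ 0ℝ
    spanning    : ∀ {v} → v ∈ Member → ∃[ c ] v ≋ linearCombination c vectors

-- The nonempty set base + direction.
record AffineSubspace (n : ℕ) : Set₁ where
  field
    base      : ℝ^ n
    direction : LinearSubspace n

  Points : Pred (ℝ^ n) 0ℓ
  Points x = (x -ⱽ base) ∈ LinearSubspace.Member direction

open AffineSubspace public using (Points)

HasDimension : ∀ {n} → AffineSubspace n → ℕ → Set
HasDimension S k = Basis (AffineSubspace.direction S) k

ℍ^ : ∀ n → Pred (ℝ^ n) 0ℓ
ℍ^ n x = ∀ i → x i ≈ 0ℝ ⊎ x i ≈ 1ℝ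

-- Points of a subset of ℝⁿ are counted up to equality of real vectors,
-- irrespective of the proof of membership.
subsetSetoid : ∀ {n} → Pred (ℝ^ n) 0ℓ → Setoid 0ℓ 0ℓ
subsetSetoid {n} P = On.setoid {B = ∃ P} (≋-setoid n) proj₁

HasCardinality : ∀ {n} → Pred (ℝ^ n) 0ℓ → ℕ → Set
HasCardinality P t = Bijection (≡.setoid (Fin t)) (subsetSetoid P)

-- H n k is the set of nonzero cardinalities of k-dimensional affine sections of
-- ℍ^ n; it is of interest for 1 ≤ k ≤ n but makes sense for all n and k.
H : (n k : ℕ) → Pred ℕ (suc 0ℓ)
H n k t = 0 ℕ.< t ×
  Σ (AffineSubspace n) λ S →
    HasDimension S k × HasCardinality (ℍ^ n ∩ Points S) t

{-# OPTIONS --safe #-}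

-- For a k × m matrix A the graph {(x , xA)} is a k-dimensional subspace of
-- ℝ^(k+m), and it meets the hypercube in one point for each x ∈ {0,1}^k with
-- xA ∈ {0,1}^m.  With t the first and y the remaining coordinates of x, and s
-- the sum of the coordinates of y, the three cardinalities are those for
-- xA = t + s,  xA = (s , s - t)  and  xA = (y₁ + t , … , y_{k-1} + t).
module Submission where

open import Defs using (H)
open import Data.Nat.Base using (ℕ; _+_; _*_; _∸_; _^_; _≤_)
open import Data.Product.Base using (_×_)
open import Relation.Unary using (_∈_)

open import Algebra.Bundles using (CommutativeRing; CommutativeSemiring)
import Algebra.Properties.CommutativeMonoid.Sum as CommutativeMonoidSum
import Algebra.Properties.Group as GroupProperties
import Algebra.Properties.Semiring.Sum as SemiringSum
open import Data.Bool.Base using (Bool; true; false)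
open import Data.Empty using (⊥-elim)
open import Data.Fin.Base using (Fin; zero; suc; _↑ˡ_; _↑ʳ_; splitAt; join)
open import Data.Fin.Properties using (+↔⊎; join-splitAt)
open import Data.Nat.Base as ℕ using (zero; suc)
import Data.Nat.Properties as ℕ
open import Data.Product.Base using (∃; _,_; proj₁; proj₂)
open import Data.Rational.Base as ℚ using (ℚ; 0ℚ; 1ℚ)
import Data.Rational.Properties as ℚ
open import Data.Sum.Base using (_⊎_; inj₁; inj₂; [_,_]; map)
open import Data.Unit.Base using (⊤; tt)
open import Data.Vec.Base using (Vec; []; _∷_; lookup; tabulate)
open import Data.Vec.Functional as Vector using (Vector; take; drop)
open import Data.Vec.Functional.Properties using (lookup-++ˡ; lookup-++ʳ)
open import Data.Vec.Properties using (lookup∘tabulate; tabulate∘lookup; tabulate-cong; ∷-injectiveʳ)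
open import Function.Base using (_∘_; const)
open import Function.Bundles using (Bijection)
import Function.Construct.Composition as Compose
open import Function.Properties.Inverse using (Inverse⇒Bijection)
open import Level using (0ℓ)
open import Relation.Binary.Bundles using (Setoid)
import Relation.Binary.Construct.On as On
open import Relation.Binary.PropositionalEquality
  using (_≡_; refl; sym; trans; cong; subst; setoid)
import Relation.Binary.Reasoning.Setoid as SetoidReasoning
open import Relation.Nullary using (¬_; yes; no; contradiction)
open import Relation.Unary using (Pred; Empty; _⊆_; _∩_)

open Defs using
  ( Real; fromℚ; _≈_; close; pointwise⇒≈; module ℝ; 0ℝ; 1ℝ; ℝ^; _≋_; linearCombination
  ; LinearSubspace; Basis; AffineSubspace; Points; ℍ^; 0ⱽ; _-ⱽ_)

-- Unit vectors over a commutative semiring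

module UnitVectors {c ℓ} (R : CommutativeSemiring c ℓ) where

  open CommutativeSemiring R hiding (zero; refl)
    renaming (_+_ to _⊕_; _*_ to _⊗_; _≈_ to _≃_; sym to ≃-sym; trans to ≃-trans)
  open SemiringSum semiring
  open SetoidReasoning (CommutativeSemiring.setoid R)

  unit : ∀ {n} → Fin n → Vector Carrier n
  unit zero    zero    = 1#
  unit zero    (suc i) = 0#
  unit (suc j) zero    = 0#
  unit (suc j) (suc i) = unit j i

  unit-sym : ∀ {n} (i j : Fin n) → unit i j ≡ unit j i
  unit-sym zero    zero    = refl
  unit-sym zero    (suc j) = refl
  unit-sym (suc i) zero    = refl
  unit-sym (suc i) (suc j) = unit-sym i j

  sum-*-unit : ∀ {n} (f : Vector Carrier n) i → sum (λ j → f j ⊗ unit j i) ≃ f i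
  sum-*-unit {suc n} f zero = begin
    f zero ⊗ 1# ⊕ sum (λ j → f (suc j) ⊗ 0#)
      ≈⟨ +-cong (*-identityʳ _) (≃-trans (sum-cong-≋ (λ j → zeroʳ (f (suc j)))) (sum-replicate-zero n)) ⟩
    f zero ⊕ 0#
      ≈⟨ +-identityʳ _ ⟩
    f zero ∎
  sum-*-unit f (suc i) = begin
    f zero ⊗ 0# ⊕ sum (λ j → f (suc j) ⊗ unit j i)
      ≈⟨ +-cong (zeroʳ _) (sum-*-unit (f ∘ suc) i) ⟩
    0# ⊕ f (suc i)
      ≈⟨ +-identityˡ _ ⟩
    f (suc i) ∎

  sum-unit-* : ∀ {n} (f : Vector Carrier n) i → sum (λ j → unit i j ⊗ f j) ≃ f i
  sum-unit-* f i = ≃-trans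
    (sum-cong-≋ λ j → ≃-trans (*-comm _ _) (*-congˡ (reflexive (unit-sym i j))))
    (sum-*-unit f i)

-- The unit vectors over ℝ enter the basis of the graph, those over ℚ the matrix of the third
-- section.
module Unitℝ = UnitVectors ℝ.commutativeSemiring
module Unitℚ = UnitVectors (CommutativeRing.commutativeSemiring ℚ.+-*-commutativeRing)
module Sumℝ = SemiringSum ℝ.semiring
module Sumℚ = CommutativeMonoidSum ℚ.+-0-commutativeMonoid

-- Subsets of {0,1}^k

-- Elements are compared by their vectors alone, as in `subsetSetoid`, so different membership
-- proofs never give different elements.
subsetOf : ∀ {k} → Pred (Vec Bool k) 0ℓ → Setoid 0ℓ 0ℓ
subsetOf {k} P = On.setoid {B = ∃ P} (setoid (Vec Bool k)) proj₁

Counts : ∀ {k} → Pred (Vec Bool k) 0ℓ → ℕ → Set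
Counts P t = Bijection (setoid (Fin t)) (subsetOf P)

module _ {k} {P Q : Pred (Vec Bool k) 0ℓ} where

  counts-resp : ∀ {t} → P ⊆ Q → Q ⊆ P → Counts P t → Counts Q t
  counts-resp P⊆Q Q⊆P c = record
    { to        = λ i → proj₁ (to i) , P⊆Q (proj₂ (to i))
    ; cong      = λ { refl → refl }
    ; bijective = injective
                , λ (b , q) → let (i , h) = surjective (b , Q⊆P q) in i , h
    } where open Bijection c

counts-empty : ∀ {k} {P : Pred (Vec Bool k) 0ℓ} → Empty P → Counts P 0
counts-empty empty = record
  { to        = λ ()
  ; cong      = λ { {()} }
  ; bijective = (λ { {()} }) , λ (b , p) → ⊥-elim (empty b p)
  }

counts-[] : {P : Pred (Vec Bool 0) 0ℓ} → [] ∈ P → Counts P 1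
counts-[] p = record
  { to        = λ _ → [] , p
  ; cong      = λ _ → refl
  ; bijective = (λ { {zero} {zero} _ → refl }) , λ { ([] , _) → zero , λ _ → refl }
  }

-- Every count below is a recursion on the first coordinate: the vectors starting with `false` and
-- those starting with `true` are counted separately.
counts-∷ : ∀ {k m n} {P : Pred (Vec Bool (suc k)) 0ℓ} →
           Counts (P ∘ (false ∷_)) m → Counts (P ∘ (true ∷_)) n → Counts P (m + n)
counts-∷ {m = m} {n} {P} c₀ c₁ = Compose.bijection (Inverse⇒Bijection +↔⊎) both
  where
  module C₀ = Bijection c₀
  module C₁ = Bijection c₁

  both : Bijection (setoid (Fin m ⊎ Fin n)) (subsetOf P)
  both = record
    { to        = f
    ; cong      = λ { refl → refl }
    ; bijective = f-injective , f-surjective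
    }
    where
    f : Fin m ⊎ Fin n → ∃ P
    f (inj₁ i) = false ∷ proj₁ (C₀.to i) , proj₂ (C₀.to i)
    f (inj₂ i) = true  ∷ proj₁ (C₁.to i) , proj₂ (C₁.to i)

    f-injective : ∀ {i j} → proj₁ (f i) ≡ proj₁ (f j) → i ≡ j
    -- The mixed cases are void, since the first coordinates differ.
    f-injective {inj₁ i} {inj₁ j} eq = cong inj₁ (C₀.injective (∷-injectiveʳ eq))
    f-injective {inj₂ i} {inj₂ j} eq = cong inj₂ (C₁.injective (∷-injectiveʳ eq))

    f-surjective : ∀ y → ∃ λ i → ∀ {j} → j ≡ i → proj₁ (f j) ≡ proj₁ y
    f-surjective (false ∷ b , p) = let (i , h) = C₀.surjective (b , p) in
      inj₁ i , λ { refl → cong (false ∷_) (h refl) }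
    f-surjective (true  ∷ b , p) = let (i , h) = C₁.surjective (b , p) in
      inj₂ i , λ { refl → cong (true ∷_) (h refl) }

counts-all : ∀ k → Counts {k} (const ⊤) (2 ^ k)
counts-all zero    = counts-[] tt
counts-all (suc k) = counts-∷ (counts-all k)
  -- `2 ^ suc k` unfolds to `2 ^ k + (2 ^ k + 0)`.
  (subst (Counts (const ⊤)) (sym (ℕ.+-identityʳ (2 ^ k))) (counts-all k))

counts-false : ∀ k → Counts {k} (λ b → ∀ i → lookup b i ≡ false) 1
counts-false zero    = counts-[] λ ()
counts-false (suc k) = counts-∷
  (counts-resp (λ h → λ { zero → refl ; (suc i) → h i }) (_∘ suc) (counts-false k))
  (counts-empty λ b h → contradiction (h zero) λ ())

-- Bit vectors times rational columns, and weights

⟦_⟧ : Bool → ℚ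
⟦ false ⟧ = 0ℚ
⟦ true ⟧  = 1ℚ

IsBit : Pred ℚ 0ℓ
IsBit q = q ≡ 0ℚ ⊎ q ≡ 1ℚ

⟦⟧-isBit : ∀ b → IsBit ⟦ b ⟧
⟦⟧-isBit false = inj₁ refl
⟦⟧-isBit true  = inj₂ refl

⟦⟧-injective : ∀ {b c} → ⟦ b ⟧ ≡ ⟦ c ⟧ → b ≡ c
⟦⟧-injective {false} {false} _ = refl
⟦⟧-injective {true}  {true}  _ = refl

infix 7 _∙_

-- One coordinate of `xA`. It is computed in ℚ, where closed terms evaluate and equality is `_≡_`.
_∙_ : ∀ {k} → Vec Bool k → Vector ℚ k → ℚ
b ∙ a = Sumℚ.sum λ j → ⟦ lookup b j ⟧ ℚ.* a j

false∷-∙ : ∀ {k} (b : Vec Bool k) a → (false ∷ b) ∙ a ≡ b ∙ (a ∘ suc)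
false∷-∙ b a = trans (cong (ℚ._+ b ∙ (a ∘ suc)) (ℚ.*-zeroˡ (a zero))) (ℚ.+-identityˡ _)

true∷-∙ : ∀ {k} (b : Vec Bool k) a → (true ∷ b) ∙ a ≡ a zero ℚ.+ b ∙ (a ∘ suc)
true∷-∙ b a = cong (ℚ._+ b ∙ (a ∘ suc)) (ℚ.*-identityˡ (a zero))

∙-unit : ∀ {k} (b : Vec Bool k) i → b ∙ (λ j → Unitℚ.unit j i) ≡ ⟦ lookup b i ⟧
∙-unit b = Unitℚ.sum-*-unit (λ j → ⟦ lookup b j ⟧)

weight : ∀ {k} → Vec Bool k → ℚ
weight b = b ∙ const 1ℚ

weight≥0 : ∀ {k} (b : Vec Bool k) → 0ℚ ℚ.≤ weight b
weight≥0 []          = ℚ.≤-refl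
weight≥0 (false ∷ b) = subst (0ℚ ℚ.≤_) (sym (false∷-∙ b (const 1ℚ))) (weight≥0 b)
-- The closed product `1ℚ ℚ.* 1ℚ` evaluates, so `weight (true ∷ b)` is `1ℚ ℚ.+ weight b` by
-- computation. The counts by weight rely on this as well.
weight≥0 (true  ∷ b) = ℚ.+-mono-≤ (ℚ.nonNegative⁻¹ 1ℚ) (weight≥0 b)

1+weight≢0 : ∀ {k} (b : Vec Bool k) → ¬ (1ℚ ℚ.+ weight b ≡ 0ℚ)
1+weight≢0 b eq = ℚ.<-irrefl (sym eq) (ℚ.+-mono-<-≤ (ℚ.positive⁻¹ 1ℚ) (weight≥0 b))

1+q≡1⇒q≡0 : ∀ q → 1ℚ ℚ.+ q ≡ 1ℚ → q ≡ 0ℚ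
1+q≡1⇒q≡0 q = GroupProperties.∙-cancelˡ ℚ.+-0-group 1ℚ q 0ℚ

counts-weight≡0 : ∀ k → Counts {k} (λ b → weight b ≡ 0ℚ) 1
counts-weight≡0 zero    = counts-[] refl
counts-weight≡0 (suc k) = counts-∷
  (counts-resp (λ {b} → trans (false∷-∙ b (const 1ℚ))) (λ {b} → trans (sym (false∷-∙ b (const 1ℚ))))
    (counts-weight≡0 k))
  (counts-empty 1+weight≢0)

-- These are the unit vectors: after `false` the weight 1 is still to come, after `true` only the
-- zero vector may follow.
counts-weight≡1 : ∀ k → Counts {k} (λ b → weight b ≡ 1ℚ) k
counts-weight≡1 zero    = counts-empty λ { [] () }
counts-weight≡1 (suc k) = subst (Counts _) (ℕ.+-comm k 1) (counts-∷
  (counts-resp (λ {b} → trans (false∷-∙ b (const 1ℚ))) (λ {b} → trans (sym (false∷-∙ b (const 1ℚ))))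
    (counts-weight≡1 k))
  (counts-resp (λ {b} → cong (1ℚ ℚ.+_)) (λ {b} → 1+q≡1⇒q≡0 (weight b))
    (counts-weight≡0 k)))

-- The zero vector and the k unit vectors. After a leading `true` the rest has weight 0, because
-- weights are nonnegative.
counts-weight-isBit : ∀ k → Counts {k} (IsBit ∘ weight) (k + 1)
counts-weight-isBit zero    = counts-[] (inj₁ refl)
counts-weight-isBit (suc k) = subst (Counts _) (ℕ.+-comm (k + 1) 1) (counts-∷
  (counts-resp (λ {b} → subst IsBit (sym (false∷-∙ b (const 1ℚ)))) (λ {b} → subst IsBit (false∷-∙ b (const 1ℚ)))
    (counts-weight-isBit k))
  (counts-resp (λ {b} → inj₂ ∘ cong (1ℚ ℚ.+_))
    (λ {b} → [ ⊥-elim ∘ 1+weight≢0 b , 1+q≡1⇒q≡0 (weight b) ])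
    (counts-weight≡0 k)))

-- Graphs of linear maps

-- If p and q differ, taking ε as their distance makes that distance smaller than itself. This
-- carries equations between real coordinates back to ℚ.
fromℚ-injective : ∀ {p q} → fromℚ p ≈ fromℚ q → p ≡ q
fromℚ-injective {p} {q} p≈q with p ℚ.- q ℚ.≟ 0ℚ
... | yes p-q≡0 = GroupProperties.x∙y⁻¹≈ε⇒x≈y ℚ.+-0-group p q p-q≡0
... | no  p-q≢0 =
  let d>0     = ℚ.≰⇒> λ d≤0 → p-q≢0 (ℚ.∣p∣≡0⇒p≡0 _ (ℚ.≤-antisym d≤0 (ℚ.0≤∣p∣ _)))
      (N , h) = close p≈q ℚ.∣ p ℚ.- q ∣ d>0
  in contradiction (h N N ℕ.≤-refl ℕ.≤-refl) (ℚ.<-irrefl refl)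

sum-fromℚ : ∀ {k} (f : Vector ℚ k) → Sumℝ.sum (fromℚ ∘ f) ≈ fromℚ (Sumℚ.sum f)
sum-fromℚ {zero}  f = ℝ.refl
sum-fromℚ {suc k} f = ℝ.trans (ℝ.+-congˡ (sum-fromℚ (f ∘ suc))) (pointwise⇒≈ λ _ → refl)

isBit-fromℚ : ∀ {q} → IsBit q → fromℚ q ≈ 0ℝ ⊎ fromℚ q ≈ 1ℝ
isBit-fromℚ = map (ℝ.reflexive ∘ cong fromℚ) (ℝ.reflexive ∘ cong fromℚ)

linearCombination-cong : ∀ {n k} {c d : Vector Real k} (B : Vector (ℝ^ n) k) →
  c ≋ d → linearCombination c B ≋ linearCombination d B
linearCombination-cong B c≋d i = Sumℝ.sum-cong-≋ λ j → ℝ.*-congʳ (c≋d j)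

≋-split : ∀ {k m} {v w : ℝ^ (k + m)} → take k v ≋ take k w → drop k v ≋ drop k w → v ≋ w
≋-split {k} {m} {v} {w} p q i =
  subst (λ i → v i ≈ w i) (join-splitAt k m i) (go (splitAt k i))
  where
  go : ∀ s → v (join k m s) ≈ w (join k m s)
  go (inj₁ j) = p j
  go (inj₂ j) = q j

module Graph {k m} (B : Vector (ℝ^ m) k) where

  OnGraph : Pred (ℝ^ (k + m)) 0ℓ
  OnGraph v = drop k v ≋ linearCombination (take k v) B

  onGraph-resp : ∀ {v w} → v ≋ w → OnGraph v → OnGraph w
  onGraph-resp v≋w p i = ℝ.trans (ℝ.sym (v≋w (k ↑ʳ i)))
    (ℝ.trans (p i) (linearCombination-cong B (λ j → v≋w (j ↑ˡ m)) i))

  subspace : LinearSubspace (k + m)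
  subspace = record
    { Member = OnGraph
    ; resp   = onGraph-resp
    ; 0∈     = λ i → ℝ.sym (ℝ.trans (Sumℝ.sum-cong-≋ λ j → ℝ.zeroˡ (B j i)) (Sumℝ.sum-replicate-zero k))
    ; +∈     = λ {v} {w} p q i → ℝ.trans (ℝ.+-cong (p i) (q i)) (ℝ.sym (ℝ.trans
        (Sumℝ.sum-cong-≋ λ j → ℝ.distribʳ (B j i) (v (j ↑ˡ m)) (w (j ↑ˡ m)))
        (Sumℝ.∑-distrib-+ (λ j → v (j ↑ˡ m) Defs.* B j i) (λ j → w (j ↑ˡ m) Defs.* B j i))))
    ; ·∈     = λ c {v} p i → ℝ.trans (ℝ.*-congˡ (p i)) (ℝ.trans
        (Sumℝ.*-distribˡ-sum c (λ j → v (j ↑ˡ m) Defs.* B j i))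
        (Sumℝ.sum-cong-≋ λ j → ℝ.sym (ℝ.*-assoc c (v (j ↑ˡ m)) (B j i))))
    }

  -- The rows of the block matrix (I | B).
  vectors : Vector (ℝ^ (k + m)) k
  vectors j = Unitℝ.unit j Vector.++ B j

  take-linearCombination : ∀ c → take k (linearCombination c vectors) ≋ c
  take-linearCombination c i = ℝ.trans
    (Sumℝ.sum-cong-≋ λ j → ℝ.*-congˡ (ℝ.reflexive (lookup-++ˡ (Unitℝ.unit j) (B j) i)))
    (Unitℝ.sum-*-unit c i)

  drop-linearCombination : ∀ c → drop k (linearCombination c vectors) ≋ linearCombination c B
  drop-linearCombination c i =
    Sumℝ.sum-cong-≋ λ j → ℝ.*-congˡ (ℝ.reflexive (lookup-++ʳ (Unitℝ.unit j) (B j) i))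

  -- The first k coordinates of a linear combination are its coefficients, which gives independence.
  -- They also determine a point of the graph, which gives spanning.
  basis : Basis subspace k
  basis = record
    { vectors     = vectors
    ; members     = λ j i → ℝ.trans (ℝ.reflexive (lookup-++ʳ (Unitℝ.unit j) (B j) i)) (ℝ.trans
        (ℝ.sym (Unitℝ.sum-unit-* (λ l → B l i) j))
        (linearCombination-cong B
          (λ l → ℝ.reflexive (sym (lookup-++ˡ (Unitℝ.unit j) (B j) l))) i))
    ; independent = λ c p j → ℝ.trans (ℝ.sym (take-linearCombination c j)) (p (j ↑ˡ m))
    ; spanning    = λ {v} p → take k v , ≋-split
        (λ j → ℝ.sym (take-linearCombination (take k v) j))
        (λ i → ℝ.trans (p i) (ℝ.sym (drop-linearCombination (take k v) i)))
    }

  affine : AffineSubspace (k + m)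
  affine = record { base = 0ⱽ ; direction = subspace }

  -- `Points` subtracts the base, here the origin; the result agrees with v only up to `_≋_`, so
  -- membership has to be transported.
  -0ⱽ : ∀ (v : ℝ^ (k + m)) → (v -ⱽ 0ⱽ) ≋ v
  -0ⱽ v i = pointwise⇒≈ λ n → ℚ.+-identityʳ _

  onGraph⇒point : ∀ v → OnGraph v → v ∈ Points affine
  onGraph⇒point v = onGraph-resp {v} λ i → ℝ.sym (-0ⱽ v i)

  point⇒onGraph : ∀ v → v ∈ Points affine → OnGraph v
  point⇒onGraph v = onGraph-resp {v -ⱽ 0ⱽ} (-0ⱽ v)

-- Hypercube points on the graph of a rational matrix

module _ {k m} (A : Vector (Vector ℚ m) k) where

  open Graph {k} {m} (λ j i → fromℚ (A j i))

  MapsToBits : Pred (Vec Bool k) 0ℓ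
  MapsToBits b = ∀ i → IsBit (b ∙ λ j → A j i)

  graphPoint : Vec Bool k → ℝ^ (k + m)
  graphPoint b = (λ j → fromℚ ⟦ lookup b j ⟧) Vector.++ (λ i → fromℚ (b ∙ λ j → A j i))

  take-graphPoint : ∀ b j → graphPoint b (j ↑ˡ m) ≈ fromℚ ⟦ lookup b j ⟧
  take-graphPoint b j = ℝ.reflexive (lookup-++ˡ (λ j → fromℚ ⟦ lookup b j ⟧) _ j)

  drop-graphPoint : ∀ b i → graphPoint b (k ↑ʳ i) ≈ fromℚ (b ∙ λ j → A j i)
  drop-graphPoint b i = ℝ.reflexive (lookup-++ʳ (λ j → fromℚ ⟦ lookup b j ⟧) _ i)

  linearCombination-bits : ∀ b {c : Vector Real k} → c ≋ (λ j → fromℚ ⟦ lookup b j ⟧) →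
    ∀ i → linearCombination c (λ j i → fromℚ (A j i)) i ≈ fromℚ (b ∙ λ j → A j i)
  linearCombination-bits b c≋b i = ℝ.trans
    (Sumℝ.sum-cong-≋ λ j → ℝ.trans (ℝ.*-congʳ (c≋b j)) (pointwise⇒≈ λ _ → refl))
    (sum-fromℚ λ j → ⟦ lookup b j ⟧ ℚ.* A j i)

  graphPoint-onGraph : ∀ b → OnGraph (graphPoint b)
  graphPoint-onGraph b i = ℝ.trans (drop-graphPoint b i)
    (ℝ.sym (linearCombination-bits b (take-graphPoint b) i))

  graphPoint-injective : ∀ {b c} → graphPoint b ≋ graphPoint c → b ≡ c
  graphPoint-injective {b} {c} p = trans (sym (tabulate∘lookup b))
    (trans (tabulate-cong λ j → ⟦⟧-injective (fromℚ-injective (ℝ.trans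
      (ℝ.sym (take-graphPoint b j)) (ℝ.trans (p (j ↑ˡ m)) (take-graphPoint c j)))))
    (tabulate∘lookup c))

  graphPoint∈ℍ : ∀ b → MapsToBits b → graphPoint b ∈ ℍ^ (k + m)
  graphPoint∈ℍ b p i with splitAt k i
  ... | inj₁ j = isBit-fromℚ (⟦⟧-isBit (lookup b j))
  ... | inj₂ j = isBit-fromℚ (p j)

  -- A point of the graph is determined by its first k coordinates, and for a hypercube point these
  -- are bits.
  hypercube-graph-bijection : Bijection (subsetOf MapsToBits) (Defs.subsetSetoid (ℍ^ (k + m) ∩ Points affine))
  hypercube-graph-bijection = record
    { to        = λ (b , p) →
        graphPoint b , graphPoint∈ℍ b p , onGraph⇒point (graphPoint b) (graphPoint-onGraph b)
    ; cong      = λ { refl i → ℝ.refl }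
    ; bijective = graphPoint-injective , surjective
    }
    where
    -- Membership in the hypercube is a disjunction in each coordinate, so the bit is read off its
    -- proof without deciding equality of reals.
    bit : ∀ {x} → x ≈ 0ℝ ⊎ x ≈ 1ℝ → Bool
    bit (inj₁ _) = false
    bit (inj₂ _) = true

    ≈bit : ∀ {x} (d : x ≈ 0ℝ ⊎ x ≈ 1ℝ) → x ≈ fromℚ ⟦ bit d ⟧
    ≈bit (inj₁ p) = p
    ≈bit (inj₂ p) = p

    surjective : ∀ y → ∃ λ x → ∀ {z} → proj₁ z ≡ proj₁ x → graphPoint (proj₁ z) ≋ proj₁ y
    surjective (v , v∈ℍ , v∈S) = (b , mapsToBits) , λ { refl → ≋-split
      (λ j → ℝ.trans (take-graphPoint b j) (ℝ.sym (v≈b j)))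
      (λ i → ℝ.trans (drop-graphPoint b i) (ℝ.sym (v≈bA i))) }
      where
      b : Vec Bool k
      b = tabulate λ j → bit (v∈ℍ (j ↑ˡ m))

      v≈b : ∀ j → v (j ↑ˡ m) ≈ fromℚ ⟦ lookup b j ⟧
      v≈b j = ℝ.trans (≈bit (v∈ℍ (j ↑ˡ m)))
        (ℝ.reflexive (cong (fromℚ ∘ ⟦_⟧) (sym (lookup∘tabulate _ j))))

      v≈bA : ∀ i → v (k ↑ʳ i) ≈ fromℚ (b ∙ λ j → A j i)
      v≈bA i = ℝ.trans (point⇒onGraph v v∈S i) (linearCombination-bits b v≈b i)

      mapsToBits : MapsToBits b
      mapsToBits i = map (λ p → fromℚ-injective (ℝ.trans (ℝ.sym (v≈bA i)) p))
                         (λ p → fromℚ-injective (ℝ.trans (ℝ.sym (v≈bA i)) p))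
                         (v∈ℍ (k ↑ʳ i))

  -- This reduces each of the three claims to a choice of A and a count of Boolean vectors.
  counts⇒∈H : ∀ {t} → 0 ℕ.< t → Counts MapsToBits t → t ∈ H (k + m) k
  counts⇒∈H t>0 c = t>0 , affine , basis , Compose.bijection c hypercube-graph-bijection

-- The three sections

k+1∈H : ∀ k → k + 1 ∈ H (k + 1) k
k+1∈H k = counts⇒∈H (λ _ → const 1ℚ) (ℕ.m≤n+m 1 k)
  (counts-resp const (λ h → h zero) (counts-weight-isBit k))

-- The dimension is `suc k`. For t = 0 both coordinates of `xA` equal s, so s is 0 or 1: k + 1
-- vectors. For t = 1 both s and s - 1 are bits, so s = 1: k vectors.
2k+1∈H : ∀ k → k + 1 + k ∈ H (suc k + 2) (suc k)
2k+1∈H k = counts⇒∈H A (ℕ.≤-trans (ℕ.m≤n+m 1 k) (ℕ.m≤m+n (k + 1) k)) (counts-∷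
  (counts-resp
    (λ {b} p → λ { zero       → subst IsBit (sym (false∷-∙ b λ j → A j zero)) p
                 ; (suc zero) → subst IsBit (sym (false∷-∙ b λ j → A j (suc zero))) p })
    (λ {b} h → subst IsBit (false∷-∙ b λ j → A j zero) (h zero))
    (counts-weight-isBit k))
  (counts-resp
    (λ {b} p → λ { zero → inj₂ (cong (0ℚ ℚ.+_) p)
                 ; (suc zero) → inj₁ (cong (ℚ.- 1ℚ ℚ.+_) p) })
    (λ {b} h → weight≡1 b (h zero) (h (suc zero)))
    (counts-weight≡1 k)))
  where
  A : Vector (Vector ℚ 2) (suc k)
  A zero    zero       = 0ℚ
  A zero    (suc zero) = ℚ.- 1ℚ
  A (suc j) _          = 1ℚ

  weight≡1 : ∀ b → IsBit (0ℚ ℚ.+ weight b) → IsBit (ℚ.- 1ℚ ℚ.+ weight b) → weight b ≡ 1ℚ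
  weight≡1 b (inj₂ p) _ = trans (sym (ℚ.+-identityˡ (weight b))) p
  -- For s = 0 the second coordinate would be -1, which is not a bit.
  weight≡1 b (inj₁ p) q =
    contradiction (subst (λ s → IsBit (ℚ.- 1ℚ ℚ.+ s)) (trans (sym (ℚ.+-identityˡ (weight b))) p) q)
      λ { (inj₁ ()) ; (inj₂ ()) }

-- A is the identity matrix below a row of ones. For t = 0 the image is y itself, always made of
-- bits: 2^k vectors. For t = 1 each 1 + y_i must be a bit, which forces y = 0: one vector.
2^k+1∈H : ∀ k → 2 ^ k + 1 ∈ H (suc k + k) (suc k)
2^k+1∈H k = counts⇒∈H A (ℕ.m≤n+m 1 (2 ^ k)) (counts-∷
  (counts-resp
    (λ {b} _ i → subst IsBit (sym (trans (false∷-∙ b (λ j → A j i)) (∙-unit b i))) (⟦⟧-isBit (lookup b i)))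
    (const tt)
    (counts-all k))
  (counts-resp
    (λ {b} h i → inj₂ (trans (true∷A b i) (cong (λ c → 1ℚ ℚ.+ ⟦ c ⟧) (h i))))
    (λ {b} h i → bit-false (subst IsBit (true∷A b i) (h i)))
    (counts-false k)))
  where
  A : Vector (Vector ℚ k) (suc k)
  A zero    _ = 1ℚ
  A (suc j) i = Unitℚ.unit j i

  true∷A : ∀ b i → (true ∷ b) ∙ (λ j → A j i) ≡ 1ℚ ℚ.+ ⟦ lookup b i ⟧
  true∷A b i = trans (true∷-∙ b (λ j → A j i)) (cong (1ℚ ℚ.+_) (∙-unit b i))

  bit-false : ∀ {c} → IsBit (1ℚ ℚ.+ ⟦ c ⟧) → c ≡ false
  bit-false {false} _         = refl
  bit-false {true}  (inj₁ ())
  bit-false {true}  (inj₂ ())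

proposition2p1 : ∀ (k : ℕ) → 1 ≤ k →
    (k + 1 ∈ H (k + 1) k) ×
    (2 * k ∸ 1 ∈ H (k + 2) k) ×
    (2 ^ (k ∸ 1) + 1 ∈ H (2 * k ∸ 1) k)
proposition2p1 (suc k) _ =
    -- With the dimension written as `suc k`, the exponent `suc k ∸ 1` reduces to `k`.
    k+1∈H (suc k)
  , subst (_∈ H (suc k + 2) (suc k)) k+1+k≡2k+1 (2k+1∈H k)
  , subst (λ n → 2 ^ k + 1 ∈ H n (suc k)) 1+k+k≡2k+1 (2^k+1∈H k)
  where
  1+k+k≡2k+1 : suc k + k ≡ 2 * suc k ∸ 1
  -- `2 * suc k ∸ 1` computes to `k + suc (k + 0)`.
  1+k+k≡2k+1 = trans (sym (ℕ.+-suc k k)) (cong (λ n → k + suc n) (sym (ℕ.+-identityʳ k)))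

  k+1+k≡2k+1 : k + 1 + k ≡ 2 * suc k ∸ 1
  k+1+k≡2k+1 = trans (cong (_+ k) (ℕ.+-comm k 1)) 1+k+k≡2k+1
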